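{- Let $\mathcal{C}$ be a class of distributions over $[n]$ for which the following holds: (i) there exists a semi-agnostic learner for $\mathcal{C}$, with sample complexity $q_L(n,\varepsilon,\delta)$ and agnostic constant $c$; (ii) there exists a subclass $\mathcal{C}_{\mathrm{Hard}}\subseteq\mathcal{C}$ such that testing $\mathcal{C}_{\mathrm{Hard}}$ requires $q_H(n,\varepsilon)$ samples. Suppose further that $q_L(n,\varepsilon,1/10)=o(q_H(n,\varepsilon))$. Then any tester for $\mathcal{C}$ must use $\Omega(q_H(n,\varepsilon))$ samples.
   Context: $[n]=\{1,\dots,n\}$; $\ell_1(D,\mathcal{C})=\inf_{D'\in\mathcal{C}}\|D-D'\|_1$ with $\|D-D'\|_1=\sum_i|D(i)-D'(i)|$. Asymptotics are as $n\to\infty$. A tester for a class $\mathcal{C}$: given $\varepsilon\in(0,1]$ and i.i.d. samples from an unknown arbitrary distribution $D$ over $[n]$, it distinguishes with probability at least $2/3$ between $D\in\mathcal{C}$ and $\ell_1(D,\mathcal{C})>\varepsilon$. A semi-agnostic learner for $\mathcal{C}$ with agnostic constant $c$: given i.i.d. samples from an arbitrary distribution $D$ over $[n]$ and parameters $\varepsilon,\delta$, it outputs, with probability at least $1-\delta$, a hypothesis $\hat{D}$ such that $\|D-\hat{D}\|_1\le c\cdot\mathrm{opt}_{\mathcal{C},D}+O(\varepsilon)$, where $\mathrm{opt}_{\mathcal{C},D}=\inf_{D'\in\mathcal{C}}\|D'-D\|_1$ and $c\ge1$ is an absolute constant.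
   Formalization: Added assumption: rescaling ε by a constant changes q_H(n,ε) by at most a constant factor; without it the O(ε) slack of the learner makes the claim false. "Requires" and Ω are read for n large and ε below an absolute constant. -}

module Defs where

open import Level using (0ℓ)
open import Algebra.Bundles using (CommutativeRing)
open import Algebra.Core using (Op₁)
open import Data.Bool.Base using (Bool; true; false; if_then_else_)
import Data.Bool.Properties as Bool
open import Data.Fin.Base using (Fin)
open import Data.Nat.Base as ℕ using (ℕ; zero; suc)
open import Data.Product.Base using (∃; ∃-syntax; _×_; proj₁)
open import Data.Vec.Base using (Vec; []; _∷_)
open import Function.Definitions using (Congruent)
open import Relation.Binary.Core using (Rel)
open import Relation.Binary.Bundles using (DecTotalOrder)
open import Relation.Binary.Structures using (IsDecTotalOrder)
open import Relation.Nullary.Decidable using (does)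
open import Relation.Unary using (Pred; Decidable)
import Relation.Binary.Construct.NonStrictToStrict as ToStrict
import Algebra.Construct.NaturalChoice.Max as Max
import Algebra.Definitions.RawMonoid as RawMonoidDefs

-- The library has no real numbers.  Classically they are the unique
-- Dedekind-complete ordered field, so everything below is stated over an
-- arbitrary such field (with a setoid equality).

record CompleteOrderedField : Set₁ where
  field
    commutativeRing : CommutativeRing 0ℓ 0ℓ

  open CommutativeRing commutativeRing public renaming (Carrier to ℝ)

  infix 4 _≤_
  infix 9 _⁻¹

  field
    _≤_             : Rel ℝ 0ℓ
    isDecTotalOrder : IsDecTotalOrder _≈_ _≤_
    +-monoˡ-≤       : ∀ {x y} z → x ≤ y → x + z ≤ y + z
    *-nonneg        : ∀ {x y} → 0# ≤ x → 0# ≤ y → 0# ≤ x * y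
    0≉1             : 0# ≉ 1#
    -- total, with an unspecified value at 0#
    _⁻¹             : Op₁ ℝ
    *-inverseʳ      : ∀ {x} → x ≉ 0# → x * x ⁻¹ ≈ 1#

  IsLowerBound : {I : Set} → (I → ℝ) → ℝ → Set
  IsLowerBound f b = ∀ i → b ≤ f i

  IsInfimum : {I : Set} → (I → ℝ) → ℝ → Set
  IsInfimum f x = IsLowerBound f x × (∀ b → IsLowerBound f b → b ≤ x)

  field
    complete : {I : Set} (f : I → ℝ) → I → ∃ (IsLowerBound f) → ∃ (IsInfimum f)

  decTotalOrder : DecTotalOrder 0ℓ 0ℓ 0ℓ
  decTotalOrder = record { isDecTotalOrder = isDecTotalOrder }

  open DecTotalOrder decTotalOrder public using (_≤?_; totalOrder)
  open ToStrict _≈_ _≤_ public using (_<_)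
  open Max totalOrder public using (_⊔_)
  open RawMonoidDefs +-rawMonoid public using (sum) renaming (_×_ to _·_)

  ∣_∣ : Op₁ ℝ
  ∣ x ∣ = x ⊔ - x

  fromℕ : ℕ → ℝ
  fromℕ n = n · 1#

  ⅔ : ℝ
  ⅔ = fromℕ 2 * fromℕ 3 ⁻¹

  ⅒ : ℝ
  ⅒ = fromℕ 10 ⁻¹

module DistributionTesting (R : CompleteOrderedField) where

  open CompleteOrderedField R

  record Distribution (n : ℕ) : Set where
    field
      mass   : Fin n → ℝ
      nonneg : ∀ i → 0# ≤ mass i
      total  : sum mass ≈ 1#

  open Distribution public

  ‖_-_‖₁ : ∀ {n} → Distribution n → Distribution n → ℝ
  ‖ D - D′ ‖₁ = sum (λ i → ∣ mass D i - mass D′ i ∣)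

  -- One set of distributions over [n] for every n.
  Class : Set₁
  Class = ∀ n → Pred (Distribution n) 0ℓ

  -- ℓ₁ C D x  says that x = ℓ₁(D,C) = opt_{C,D}.  It is a relation because
  -- there is no such real x when C n is empty; the infimum is then +∞.
  ℓ₁ : Class → ∀ {n} → Distribution n → ℝ → Set
  ℓ₁ C {n} D = IsInfimum {I = ∃ (C n)} (λ D′ → ‖ D - proj₁ D′ ‖₁)

  -- ℓ₁(D,C) > ε, including the case ℓ₁(D,C) = +∞.
  Far : Class → ∀ {n} → ℝ → Distribution n → Set
  Far C ε D = ∀ x → ℓ₁ C D x → ε < x

  𝔼 : ∀ {n} → Distribution n → (Fin n → ℝ) → ℝ
  𝔼 D f = sum (λ i → mass D i * f i)

  -- Expectation over m independent samples, as an iterated expectation.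
  𝔼^ : ∀ {n} m → Distribution n → (Vec (Fin n) m → ℝ) → ℝ
  𝔼^ zero    D f = f []
  𝔼^ (suc m) D f = 𝔼 D (λ i → 𝔼^ m D (λ xs → f (i ∷ xs)))

  -- A (possibly randomised) algorithm that draws m samples from [n]; its
  -- internal randomness is one draw, independent of the samples, from an
  -- arbitrary finite distribution.
  record Algorithm (A : Set) (n m : ℕ) : Set where
    field
      seeds : ℕ
      coin  : Distribution seeds
      run   : Vec (Fin n) m → Fin seeds → A

  -- Pr D T P?  is the probability that T, run on samples from D, returns an
  -- output satisfying P.
  Pr : ∀ {n m} {A : Set} {P : Pred A 0ℓ} →
       Distribution n → Algorithm A n m → Decidable P → ℝ
  Pr {m = m} D T P? =
    𝔼^ m D (λ xs → 𝔼 coin (λ s → if does (P? (run xs s)) then 1# else 0#))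
    where open Algorithm T

  -- true means "accept".
  IsTester : Class → ∀ {n m} → ℝ → Algorithm Bool n m → Set
  IsTester C {n} ε T = (D : Distribution n) →
    (C n D   → ⅔ ≤ Pr D T (Bool._≟ true)) ×
    (Far C ε D → ⅔ ≤ Pr D T (Bool._≟ false))

  -- K is the constant hidden in the O(ε) of the guarantee.
  IsLearner : Class → (c K : ℝ) → ∀ {n m} → (ε δ : ℝ) →
              Algorithm (Distribution n) n m → Set
  IsLearner C c K {n} ε δ L = (D : Distribution n) → ∀ opt → ℓ₁ C D opt →
    1# - δ ≤ Pr D L (λ D̂ → ‖ D - D̂ ‖₁ ≤? c * opt + K * ε)

  SemiAgnosticLearner : Class → (c : ℝ) → (q : ℕ → ℝ → ℝ → ℕ) → Set
  SemiAgnosticLearner C c q = ∃[ K ] 0# < K ×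
    (∀ n ε δ → 0# < ε → ε ≤ 1# → 0# < δ → δ < 1# →
     ∃ λ (L : Algorithm (Distribution n) n (q n ε δ)) → IsLearner C c K ε δ L)

  -- Every tester for C uses Ω(q(n,ε)) samples.  The limit is n → ∞ for fixed
  -- small ε; the constant a does not depend on ε.
  TestingRequires : Class → (q : ℕ → ℝ → ℝ) → Set
  TestingRequires C q =
    ∃[ a ] 0# < a × ∃[ ε₀ ] 0# < ε₀ × ε₀ ≤ 1# ×
    (∀ ε → 0# < ε → ε ≤ ε₀ → ∃[ N ] ∀ n → N ℕ.≤ n →
     ∀ m (T : Algorithm Bool n m) → IsTester C ε T → a * q n ε ≤ fromℕ m)

  -- f(n,ε) = o(g(n,ε)) as n → ∞, for every fixed ε.
  LittleO : (ℕ → ℝ → ℕ) → (ℕ → ℝ → ℝ) → Set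
  LittleO f g = ∀ ε → 0# < ε → ε ≤ 1# → ∀ η → 0# < η →
    ∃[ N ] ∀ n → N ℕ.≤ n → fromℕ (f n ε) ≤ η * g n ε

  -- q is a function of the real number ε, and scaling ε by a constant changes
  -- q by at most a constant factor, as for any bound f(n)/ε^k.  Because the
  -- learner's error is only O(ε), this is what makes comparing bounds at the
  -- same ε meaningful.
  record IsComplexityBound (q : ℕ → ℝ → ℝ) : Set where
    field
      cong       : ∀ n → Congruent _≈_ _≈_ (q n)
      rescalable : ∀ γ → 0# < γ → γ ≤ 1# → ∃[ A ] 0# < A ×
        (∀ ε → 0# < ε → ε ≤ 1# →
         ∃[ N ] ∀ n → N ℕ.≤ n → q n (γ * ε) ≤ A * q n ε)

{-# OPTIONS --safe #-}
module Submission where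

-- To test C_Hard with parameter (c + 2K) ε, run a tester T for C and the
-- learner, both with parameter ε, and accept iff T accepts and some member of
-- C_Hard is within K ε of the hypothesis D̂.  If D ∈ C_Hard then opt = 0, and D
-- itself is such a member.  If D is far from C_Hard, then either T rejects, or
-- opt ≤ ε, and any such member would be within (c + 2K) ε of D.  Taking the
-- majority of three runs of T makes the acceptance probability at least
-- 20/27 · 9/10 = 2/3.  The test uses 3m + q_L samples; as q_L = o(q_H), the
-- lower bound for C_Hard forces m = Ω(q_H).

open import Defs
open import Level using (0ℓ)
open import Data.Bool.Base using (Bool; true; false; not; _∧_; _∨_; if_then_else_)
import Data.Bool.Properties as Bool
open import Data.Fin.Base using (Fin; zero; suc; _↑ˡ_; _↑ʳ_; combine; remQuot)
open import Data.Fin.Properties using (remQuot-combine)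
open import Data.Maybe.Base using (Maybe; just; nothing; maybe)
open import Data.Nat.Base as ℕ using (ℕ; zero; suc)
import Data.Nat.Properties as ℕ
open import Data.Product.Base using (∃-syntax; _×_; _,_; proj₁; proj₂)
open import Data.Sum.Base using (inj₁; inj₂)
open import Data.Vec.Base using (Vec; []; _∷_; take; drop)
open import Function.Base using (_∘_; const)
open import Relation.Binary.Bundles using (DecTotalOrder)
open import Relation.Binary.PropositionalEquality.Core as ≡ using (_≡_)
open import Relation.Nullary.Decidable using (Dec; yes; no; does; decidable-stable; map′)
open import Relation.Nullary.Negation using (¬_; contradiction)
open import Relation.Unary using (Pred; Decidable; _⊆_)
import Algebra.Construct.NaturalChoice.Max as Max
import Algebra.Properties.AbelianGroup as AbelianGroupProperties
import Algebra.Properties.Group as GroupProperties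
import Algebra.Properties.Monoid.Mult as MultProperties
import Algebra.Properties.Ring as RingProperties
import Algebra.Properties.Semiring.Sum as SumProperties
import Algebra.Solver.Ring.NaturalCoefficients.Default as Solver
import Relation.Binary.Construct.NonStrictToStrict as ToStrict
import Relation.Binary.Reasoning.PartialOrder as ≤-Reasoning

-- Ordered-field arithmetic.

module OrderedFieldProperties (R : CompleteOrderedField) where

  open CompleteOrderedField R hiding (zero)
  open DecTotalOrder decTotalOrder public
    using (total; antisym; poset; ≤-respˡ-≈; ≤-respʳ-≈)
    renaming (refl to ≤-refl; trans to ≤-trans; reflexive to ≤-reflexive)
  open ≤-Reasoning poset public
  open Max totalOrder using (x≤x⊔y; x≤y⊔x; ⊔-lub; ⊔-cong; ⊔-comm)
  open RingProperties ring using (-‿distribˡ-*)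
  open GroupProperties +-group using ()
    renaming (∙-cancelʳ to +-cancelʳ; ⁻¹-involutive to -‿involutive)
  open AbelianGroupProperties +-abelianGroup using ()
    renaming (⁻¹-anti-homo‿- to -‿anti-homo‿-)
  open SumProperties semiring using (sum-replicate-zero; sum-cong-≋)
  open MultProperties +-monoid using (×-homo-+)
  open Solver commutativeSemiring using (Polynomial; solve; _:=_; _:+_; _:*_; con)

  <⇒≤ : ∀ {x y} → x < y → x ≤ y
  <⇒≤ = proj₁

  <⇒≱ : ∀ {x y} → x < y → ¬ y ≤ x
  <⇒≱ = ToStrict.<⇒≱ _≈_ _≤_ antisym

  ≰⇒> : ∀ {x y} → ¬ x ≤ y → y < x
  ≰⇒> = ToStrict.≰⇒> _≈_ _≤_ sym ≤-reflexive total

  <-≤-trans : ∀ {x y z} → x < y → y ≤ z → x < z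
  <-≤-trans = ToStrict.<-≤-trans _≈_ _≤_ sym ≤-trans antisym ≤-respʳ-≈

  +-monoʳ-≤ : ∀ {x y} z → x ≤ y → z + x ≤ z + y
  +-monoʳ-≤ {x} {y} z x≤y = begin
    z + x ≈⟨ +-comm z x ⟩
    x + z ≤⟨ +-monoˡ-≤ z x≤y ⟩
    y + z ≈⟨ +-comm y z ⟩
    z + y ∎

  +-mono-≤ : ∀ {x y u v} → x ≤ y → u ≤ v → x + u ≤ y + v
  +-mono-≤ {y = y} {u} x≤y u≤v = ≤-trans (+-monoˡ-≤ u x≤y) (+-monoʳ-≤ y u≤v)

  +-nonneg : ∀ {x y} → 0# ≤ x → 0# ≤ y → 0# ≤ x + y
  +-nonneg 0≤x 0≤y = ≤-trans (≤-reflexive (sym (+-identityˡ 0#))) (+-mono-≤ 0≤x 0≤y)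

  x≤x+y : ∀ {x y} → 0# ≤ y → x ≤ x + y
  x≤x+y {x} {y} 0≤y = begin
    x      ≈⟨ +-identityʳ x ⟨
    x + 0# ≤⟨ +-monoʳ-≤ x 0≤y ⟩
    x + y  ∎

  x-y+y≈x : ∀ x y → (x - y) + y ≈ x
  x-y+y≈x x y = trans (+-assoc x (- y) y) (trans (+-congˡ (-‿inverseˡ y)) (+-identityʳ x))

  +-cancelʳ-≤ : ∀ {x y} z → x + z ≤ y + z → x ≤ y
  +-cancelʳ-≤ {x} {y} z x+z≤y+z = begin
    x           ≈⟨ lemma x ⟨
    x + z + - z ≤⟨ +-monoˡ-≤ (- z) x+z≤y+z ⟩
    y + z + - z ≈⟨ lemma y ⟩
    y           ∎
    where
    lemma : ∀ w → w + z + - z ≈ w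
    lemma w = trans (+-assoc w z (- z)) (trans (+-congˡ (-‿inverseʳ z)) (+-identityʳ w))

  x≤y⇒0≤y-x : ∀ {x y} → x ≤ y → 0# ≤ y - x
  x≤y⇒0≤y-x {x} {y} x≤y = +-cancelʳ-≤ x (begin
    0# + x    ≈⟨ +-identityˡ x ⟩
    x         ≤⟨ x≤y ⟩
    y         ≈⟨ x-y+y≈x y x ⟨
    y - x + x ∎)

  x≤0⇒0≤-x : ∀ {x} → x ≤ 0# → 0# ≤ - x
  x≤0⇒0≤-x x≤0 = ≤-trans (x≤y⇒0≤y-x x≤0) (≤-reflexive (+-identityˡ _))

  *-monoʳ-≤ : ∀ {x y z} → 0# ≤ z → x ≤ y → z * x ≤ z * y
  *-monoʳ-≤ {x} {y} {z} 0≤z x≤y = begin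
    z * x               ≤⟨ x≤x+y (*-nonneg 0≤z (x≤y⇒0≤y-x x≤y)) ⟩
    z * x + z * (y - x) ≈⟨ distribˡ z x (y - x) ⟨
    z * (x + (y - x))   ≈⟨ *-congˡ (trans (+-comm x _) (x-y+y≈x y x)) ⟩
    z * y               ∎

  *-monoˡ-≤ : ∀ {x y z} → 0# ≤ z → x ≤ y → x * z ≤ y * z
  *-monoˡ-≤ {x} {y} {z} 0≤z x≤y = begin
    x * z ≈⟨ *-comm x z ⟩
    z * x ≤⟨ *-monoʳ-≤ 0≤z x≤y ⟩
    z * y ≈⟨ *-comm z y ⟩
    y * z ∎

  *-mono-≤ : ∀ {x y u v} → 0# ≤ y → 0# ≤ u → x ≤ y → u ≤ v → x * u ≤ y * v
  *-mono-≤ 0≤y 0≤u x≤y u≤v = ≤-trans (*-monoˡ-≤ 0≤u x≤y) (*-monoʳ-≤ 0≤y u≤v)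

  0≤1 : 0# ≤ 1#
  0≤1 with total 0# 1#
  ... | inj₁ 0≤1 = 0≤1
  ... | inj₂ 1≤0 = begin
    0#              ≤⟨ *-nonneg (x≤0⇒0≤-x 1≤0) (x≤0⇒0≤-x 1≤0) ⟩
    - 1# * - 1#     ≈⟨ -‿distribˡ-* 1# (- 1#) ⟨
    - (1# * - 1#)   ≈⟨ -‿cong (*-identityˡ (- 1#)) ⟩
    - - 1#          ≈⟨ -‿involutive 1# ⟩
    1#              ∎

  0<1 : 0# < 1#
  0<1 = 0≤1 , 0≉1

  1≰0 : ¬ 1# ≤ 0#
  1≰0 = <⇒≱ 0<1

  0<x⇒x≉0 : ∀ {x} → 0# < x → x ≉ 0#
  0<x⇒x≉0 0<x x≈0 = proj₂ 0<x (sym x≈0)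

  *-inverseˡ : ∀ {x} → 0# < x → x ⁻¹ * x ≈ 1#
  *-inverseˡ 0<x = trans (*-comm _ _) (*-inverseʳ (0<x⇒x≉0 0<x))

  ⁻¹-pos : ∀ {x} → 0# < x → 0# < x ⁻¹
  ⁻¹-pos {x} 0<x = ≰⇒> λ x⁻¹≤0 → 1≰0 (begin
    1#       ≈⟨ *-inverseʳ (0<x⇒x≉0 0<x) ⟨
    x * x ⁻¹ ≤⟨ *-monoʳ-≤ (<⇒≤ 0<x) x⁻¹≤0 ⟩
    x * 0#   ≈⟨ zeroʳ x ⟩
    0#       ∎)

  *-cancelˡ-≤ : ∀ {x y z} → 0# < z → z * x ≤ z * y → x ≤ y
  *-cancelˡ-≤ {x} {y} {z} 0<z zx≤zy = begin
    x              ≈⟨ lemma x ⟨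
    z ⁻¹ * (z * x) ≤⟨ *-monoʳ-≤ (<⇒≤ (⁻¹-pos 0<z)) zx≤zy ⟩
    z ⁻¹ * (z * y) ≈⟨ lemma y ⟩
    y              ∎
    where
    lemma : ∀ w → z ⁻¹ * (z * w) ≈ w
    lemma w = trans (sym (*-assoc _ _ _)) (trans (*-congʳ (*-inverseˡ 0<z)) (*-identityˡ w))

  *-pos : ∀ {x y} → 0# < x → 0# < y → 0# < x * y
  *-pos {x} {y} 0<x 0<y = ≰⇒> λ xy≤0 → <⇒≱ 0<y
    (*-cancelˡ-≤ 0<x (≤-trans xy≤0 (≤-reflexive (sym (zeroʳ x)))))

  +-pos-nonneg : ∀ {x y} → 0# < x → 0# ≤ y → 0# < x + y
  +-pos-nonneg 0<x 0≤y = <-≤-trans 0<x (x≤x+y 0≤y)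

  fromℕ-nonneg : ∀ n → 0# ≤ fromℕ n
  fromℕ-nonneg zero    = ≤-refl
  fromℕ-nonneg (suc n) = +-nonneg 0≤1 (fromℕ-nonneg n)

  fromℕ-pos : ∀ n → 0# < fromℕ (suc n)
  fromℕ-pos n = +-pos-nonneg 0<1 (fromℕ-nonneg n)

  fromℕ-homo-+ : ∀ m n → fromℕ (m ℕ.+ n) ≈ fromℕ m + fromℕ n
  fromℕ-homo-+ = ×-homo-+ 1#

  -- Absolute values and the triangle inequality.

  ∣x∣-nonneg : ∀ x → 0# ≤ ∣ x ∣
  ∣x∣-nonneg x with total 0# x
  ... | inj₁ 0≤x = ≤-trans 0≤x (x≤x⊔y x (- x))
  ... | inj₂ x≤0 = ≤-trans (x≤0⇒0≤-x x≤0) (x≤y⊔x x (- x))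

  ∣x-y∣≈∣y-x∣ : ∀ x y → ∣ x - y ∣ ≈ ∣ y - x ∣
  ∣x-y∣≈∣y-x∣ x y = begin-equality
    (x - y) ⊔ - (x - y)     ≈⟨ ⊔-cong (sym (-‿anti-homo‿- y x)) (-‿anti-homo‿- x y) ⟩
    - (y - x) ⊔ (y - x)     ≈⟨ ⊔-comm _ _ ⟩
    (y - x) ⊔ - (y - x)     ∎

  ∣x-x∣≈0 : ∀ x → ∣ x - x ∣ ≈ 0#
  ∣x-x∣≈0 x = antisym (⊔-lub (≤-reflexive x-x≈0) (≤-reflexive (trans (-‿anti-homo‿- x x) x-x≈0)))
                      (∣x∣-nonneg _)
    where
    x-x≈0 : x - x ≈ 0#
    x-x≈0 = -‿inverseʳ x

  x-z≈[x-y]+[y-z] : ∀ x y z → x - z ≈ (x - y) + (y - z)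
  x-z≈[x-y]+[y-z] x y z = begin-equality
    x - z             ≈⟨ +-congʳ (x-y+y≈x x y) ⟨
    x - y + y - z     ≈⟨ +-assoc (x - y) y (- z) ⟩
    (x - y) + (y - z) ∎

  ∣-∣-triangle : ∀ x y z → ∣ x - z ∣ ≤ ∣ x - y ∣ + ∣ y - z ∣
  ∣-∣-triangle x y z = ⊔-lub
    (begin
      x - z                 ≈⟨ x-z≈[x-y]+[y-z] x y z ⟩
      (x - y) + (y - z)     ≤⟨ +-mono-≤ (x≤x⊔y _ _) (x≤x⊔y _ _) ⟩
      ∣ x - y ∣ + ∣ y - z ∣ ∎)
    (begin
      - (x - z)             ≈⟨ -‿anti-homo‿- x z ⟩
      z - x                 ≈⟨ x-z≈[x-y]+[y-z] z y x ⟩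
      (z - y) + (y - x)     ≈⟨ +-comm _ _ ⟩
      (y - x) + (z - y)     ≈⟨ +-cong (-‿anti-homo‿- x y) (-‿anti-homo‿- y z) ⟨
      - (x - y) + - (y - z) ≤⟨ +-mono-≤ (x≤y⊔x _ _) (x≤y⊔x _ _) ⟩
      ∣ x - y ∣ + ∣ y - z ∣ ∎)

  -- Finite sums, including sums over pairs coded in a single `Fin`.

  sum-mono : ∀ {n} {f g : Fin n → ℝ} → (∀ i → f i ≤ g i) → sum f ≤ sum g
  sum-mono {zero}  f≤g = ≤-refl
  sum-mono {suc n} f≤g = +-mono-≤ (f≤g zero) (sum-mono (f≤g ∘ suc))

  sum-nonneg : ∀ {n} {f : Fin n → ℝ} → (∀ i → 0# ≤ f i) → 0# ≤ sum f
  sum-nonneg {n} 0≤f = ≤-trans (≤-reflexive (sym (sum-replicate-zero n))) (sum-mono 0≤f)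

  sum-↑ : ∀ m {n} (f : Fin (m ℕ.+ n) → ℝ) →
          sum f ≈ sum (λ i → f (i ↑ˡ n)) + sum (λ j → f (m ↑ʳ j))
  sum-↑ zero    f = sym (+-identityˡ _)
  sum-↑ (suc m) f = trans (+-congˡ (sum-↑ m (f ∘ suc))) (sym (+-assoc _ _ _))

  sum-combine : ∀ m {n} (f : Fin (m ℕ.* n) → ℝ) →
                sum f ≈ sum (λ i → sum (λ j → f (combine {m} {n} i j)))
  sum-combine zero    f = refl
  sum-combine (suc m) {n} f = trans (sum-↑ n f) (+-congˡ (sum-combine m (f ∘ (n ↑ʳ_))))

  sum-remQuot : ∀ {m} n (g : Fin m × Fin n → ℝ) →
                sum (g ∘ remQuot n) ≈ sum (λ i → sum (λ j → g (i , j)))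
  sum-remQuot {m} n g = trans (sum-combine m (g ∘ remQuot n)) (sum-cong-≋ {m} (λ i → sum-cong-≋ {n} (λ j →
    reflexive (≡.cong g (remQuot-combine i j)))))

  -- Excluded middle is not available for membership in an arbitrary class, but
  -- this weak form is.  The infimum of {1} ∪ {0 | P} is at least 1 exactly when P fails.
  ¬-dec : (P : Set) → Dec (¬ P)
  ¬-dec P with complete f nothing (0# , maybe {B = λ w → 0# ≤ f w} (λ _ → ≤-refl) 0≤1)
    where
    f : Maybe P → ℝ
    f = maybe (const 0#) 1#
  ... | x , x≤f , greatest = map′
    (λ 1≤x p → 1≰0 (≤-trans 1≤x (x≤f (just p))))
    (λ ¬p → greatest 1# (maybe (λ p → contradiction p ¬p) ≤-refl))
    (1# ≤? x)

  -- Numerical bounds with 2/3 and 9/10.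

  1-⅒≤1 : 1# - ⅒ ≤ 1#
  1-⅒≤1 = ≤-trans (x≤x+y (<⇒≤ (⁻¹-pos (fromℕ-pos 9)))) (≤-reflexive (x-y+y≈x 1# ⅒))

  ⅒<1 : ⅒ < 1#
  -- Multiplying `1# ≤ ⅒` by 10 would give 10 ≤ 1, hence 9 ≤ 0.
  ⅒<1 = ≰⇒> λ 1≤⅒ → <⇒≱ {1#} {fromℕ 10}
    (≰⇒> λ 10≤1 → <⇒≱ (fromℕ-pos 8) (+-cancelʳ-≤ 1# (begin
      fromℕ 9 + 1# ≈⟨ +-comm _ _ ⟩
      fromℕ 10     ≤⟨ 10≤1 ⟩
      1#           ≈⟨ +-identityˡ 1# ⟨
      0# + 1#      ∎)))
    (begin
      fromℕ 10      ≈⟨ *-identityʳ _ ⟨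
      fromℕ 10 * 1# ≤⟨ *-monoʳ-≤ (fromℕ-nonneg 10) 1≤⅒ ⟩
      fromℕ 10 * ⅒  ≈⟨ *-inverseʳ (0<x⇒x≉0 (fromℕ-pos 9)) ⟩
      1#            ∎)

  private
    -- Numerals with the recursive shape of `fromℕ`, so that solved polynomial identities match
    -- goals written with `fromℕ`.
    nat : ∀ {k} → ℕ → Polynomial k
    nat zero    = con 0
    nat (suc n) = con 1 :+ nat n

    3⅓ : fromℕ 3 * fromℕ 3 ⁻¹ ≈ 1#
    3⅓ = *-inverseʳ (0<x⇒x≉0 (fromℕ-pos 2))

    10⅒ : fromℕ 10 * ⅒ ≈ 1#
    10⅒ = *-inverseʳ (0<x⇒x≉0 (fromℕ-pos 9))

  1-⅒≈9⅒ : 1# - ⅒ ≈ fromℕ 9 * ⅒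
  1-⅒≈9⅒ = +-cancelʳ ⅒ _ _ (begin-equality
    1# - ⅒ + ⅒       ≈⟨ x-y+y≈x 1# ⅒ ⟩
    1#               ≈⟨ 10⅒ ⟨
    fromℕ 10 * ⅒     ≈⟨ solve 1 (λ b → nat 10 :* b := nat 9 :* b :+ b) refl ⅒ ⟩
    fromℕ 9 * ⅒ + ⅒  ∎)

  ⅔≤1-⅒ : ⅔ ≤ 1# - ⅒
  ⅔≤1-⅒ = begin
    fromℕ 2 * θ                             ≈⟨ *-identityʳ _ ⟨
    fromℕ 2 * θ * 1#                        ≈⟨ *-congˡ 10⅒ ⟨
    -- Over the denominator 30 the two sides are 20 and 27; the added term is the difference 7/30.
    fromℕ 2 * θ * (fromℕ 10 * ⅒)            ≤⟨ x≤x+y (*-nonneg (fromℕ-nonneg 7) (*-nonneg 0≤θ 0≤⅒)) ⟩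
    fromℕ 2 * θ * (fromℕ 10 * ⅒) + fromℕ 7 * (θ * ⅒)
      ≈⟨ solve 2 (λ t b → nat 2 :* t :* (nat 10 :* b) :+ nat 7 :* (t :* b)
                            := nat 9 :* b :* (nat 3 :* t)) refl θ ⅒ ⟩
    fromℕ 9 * ⅒ * (fromℕ 3 * θ)             ≈⟨ *-cong 1-⅒≈9⅒ (sym 3⅓) ⟨
    (1# - ⅒) * 1#                           ≈⟨ *-identityʳ _ ⟩
    1# - ⅒                                  ∎
    where
    θ = fromℕ 3 ⁻¹
    0≤θ = <⇒≤ (⁻¹-pos (fromℕ-pos 2))
    0≤⅒ = <⇒≤ (⁻¹-pos (fromℕ-pos 9))

  -- Two successes out of three independent trials of success probability
  -- p ≥ 2/3 have probability at least 20/27, and 20/27 · 9/10 = 2/3.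
  majority-bound : ∀ {p q} → 0# ≤ q → p + q ≈ 1# → ⅔ ≤ p →
    ⅔ ≤ (p * (p * 1# + q * p) + q * (p * p + q * 0#)) * (1# - ⅒)
  majority-bound {p} {q} 0≤q p+q≈1 ⅔≤p = begin
    fromℕ 2 * θ                                                ≈⟨ *-identityʳ _ ⟨
    fromℕ 2 * θ * 1#                                           ≈⟨ *-congˡ ones ⟨
    fromℕ 2 * θ * (fromℕ 3 * θ * (fromℕ 3 * θ) * (fromℕ 10 * ⅒))
      ≈⟨ solve 2 (λ t b → nat 2 :* t :* (nat 3 :* t :* (nat 3 :* t) :* (nat 10 :* b))
                            := nat 20 :* (t :* t :* t) :* (nat 9 :* b)) refl θ ⅒ ⟩
    fromℕ 20 * (θ * θ * θ) * (fromℕ 9 * ⅒)                     ≈⟨ *-congˡ 1-⅒≈9⅒ ⟨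
    fromℕ 20 * (θ * θ * θ) * (1# - ⅒)                          ≤⟨ *-monoˡ-≤ 0≤1-⅒ 20θ³≤ ⟩
    (p * (p * 1# + q * p) + q * (p * p + q * 0#)) * (1# - ⅒)   ∎
    where
    θ = fromℕ 3 ⁻¹
    -- In terms of `q` and the excess `t`, both 1/3 and `p` become combinations with nonnegative
    -- coefficients. The claim then has no subtraction left and is within reach of a semiring
    -- solver.
    t = p - ⅔

    0≤t : 0# ≤ t
    0≤t = x≤y⇒0≤y-x ⅔≤p

    0≤1-⅒ : 0# ≤ 1# - ⅒
    0≤1-⅒ = x≤y⇒0≤y-x (<⇒≤ ⅒<1)

    ones : fromℕ 3 * θ * (fromℕ 3 * θ) * (fromℕ 10 * ⅒) ≈ 1#
    ones = trans (*-cong (trans (*-cong 3⅓ 3⅓) (*-identityʳ 1#)) 10⅒) (*-identityʳ 1#)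

    θ≈q+t : θ ≈ q + t
    θ≈q+t = +-cancelʳ ⅔ _ _ (begin-equality
      θ + fromℕ 2 * θ ≈⟨ solve 1 (λ t → t :+ nat 2 :* t := nat 3 :* t) refl θ ⟩
      fromℕ 3 * θ     ≈⟨ 3⅓ ⟩
      1#              ≈⟨ p+q≈1 ⟨
      p + q           ≈⟨ +-comm p q ⟩
      q + p           ≈⟨ +-congˡ (x-y+y≈x p ⅔) ⟨
      q + (t + ⅔)     ≈⟨ +-assoc q t ⅔ ⟨
      q + t + ⅔       ∎)

    p≈2q+3t : p ≈ fromℕ 2 * q + fromℕ 3 * t
    p≈2q+3t = begin-equality
      p                         ≈⟨ x-y+y≈x p ⅔ ⟨
      t + fromℕ 2 * θ           ≈⟨ +-congˡ (*-congˡ θ≈q+t) ⟩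
      t + fromℕ 2 * (q + t)
        ≈⟨ solve 2 (λ q t → t :+ nat 2 :* (q :+ t) := nat 2 :* q :+ nat 3 :* t) refl q t ⟩
      fromℕ 2 * q + fromℕ 3 * t ∎

    p′ = fromℕ 2 * q + fromℕ 3 * t

    -- This is (2q+3t)²(5q+3t) - 20(q+t)³ expanded, that is, p³ + 3p²q - 20θ³ after the
    -- substitution.
    slack = fromℕ 12 * (q * q * t) + fromℕ 21 * (q * t * t) + fromℕ 7 * (t * t * t)

    0≤slack : 0# ≤ slack
    0≤slack = +-nonneg (+-nonneg
      (*-nonneg (fromℕ-nonneg 12) (*-nonneg (*-nonneg 0≤q 0≤q) 0≤t))
      (*-nonneg (fromℕ-nonneg 21) (*-nonneg (*-nonneg 0≤q 0≤t) 0≤t)))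
      (*-nonneg (fromℕ-nonneg 7) (*-nonneg (*-nonneg 0≤t 0≤t) 0≤t))

    20θ³≤ : fromℕ 20 * (θ * θ * θ) ≤ p * (p * 1# + q * p) + q * (p * p + q * 0#)
    20θ³≤ = begin
      fromℕ 20 * (θ * θ * θ)
        ≈⟨ *-congˡ (*-cong (*-cong θ≈q+t θ≈q+t) θ≈q+t) ⟩
      fromℕ 20 * ((q + t) * (q + t) * (q + t))
        ≤⟨ x≤x+y 0≤slack ⟩
      fromℕ 20 * ((q + t) * (q + t) * (q + t)) + slack
        ≈⟨ solve 2 (λ q t →
             nat 20 :* ((q :+ t) :* (q :+ t) :* (q :+ t))
               :+ (nat 12 :* (q :* q :* t) :+ nat 21 :* (q :* t :* t) :+ nat 7 :* (t :* t :* t))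
             := (nat 2 :* q :+ nat 3 :* t) :* (nat 2 :* q :+ nat 3 :* t)
                  :* ((nat 2 :* q :+ nat 3 :* t) :+ nat 3 :* q)) refl q t ⟩
      p′ * p′ * (p′ + fromℕ 3 * q)
        ≈⟨ *-cong (*-cong p≈2q+3t p≈2q+3t) (+-congʳ p≈2q+3t) ⟨
      p * p * (p + fromℕ 3 * q)
        ≈⟨ solve 2 (λ p q → p :* p :* (p :+ nat 3 :* q)
             := p :* (p :* (p :+ q) :+ q :* p) :+ q :* (p :* p :+ q :* con 0)) refl p q ⟩
      p * (p * (p + q) + q * p) + q * (p * p + q * 0#)
        ≈⟨ +-congʳ (*-congˡ (+-congʳ (*-congˡ p+q≈1))) ⟩
      p * (p * 1# + q * p) + q * (p * p + q * 0#) ∎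

-- Expectations as monotone linear functionals.

module Expectations (R : CompleteOrderedField) where

  open CompleteOrderedField R hiding (zero)
  open DistributionTesting R
  open OrderedFieldProperties R
  open SumProperties semiring
    using (sum-cong-≋; ∑-distrib-+; *-distribˡ-sum; *-distribʳ-sum)
  open Solver commutativeSemiring using (solve; _:=_; _:*_)

  -- Sampling, iterated sampling and running an algorithm all give normalised monotone linear
  -- functionals. Such functionals are closed under composition, so their laws are proved once, from
  -- these four properties.
  record IsExpectation {A : Set} (E : (A → ℝ) → ℝ) : Set where
    field
      mono   : ∀ {f g} → (∀ a → f a ≤ g a) → E f ≤ E g
      homo-+ : ∀ f g → E (λ a → f a + g a) ≈ E f + E g
      homo-* : ∀ k f → E (λ a → k * f a) ≈ k * E f
      const≈ : ∀ k → E (const k) ≈ k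

    cong : ∀ {f g} → (∀ a → f a ≈ g a) → E f ≈ E g
    cong f≈g = antisym (mono (≤-reflexive ∘ f≈g)) (mono (≤-reflexive ∘ sym ∘ f≈g))

    nonneg-E : ∀ {f} → (∀ a → 0# ≤ f a) → 0# ≤ E f
    nonneg-E 0≤f = ≤-trans (≤-reflexive (sym (const≈ 0#))) (mono 0≤f)

    homo-*ʳ : ∀ f k → E (λ a → f a * k) ≈ E f * k
    homo-*ʳ f k = trans (cong (λ a → *-comm (f a) k)) (trans (homo-* k f) (*-comm k (E f)))

    homo-sum : ∀ {n} (h : Fin n → A → ℝ) → E (λ a → sum (λ i → h i a)) ≈ sum (λ i → E (h i))
    homo-sum {zero}  h = const≈ 0#
    homo-sum {suc n} h = trans (homo-+ (h zero) _) (+-congˡ (homo-sum (h ∘ suc)))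

  open IsExpectation

  private
    variable
      A B : Set
      n m m′ : ℕ

  return-isExpectation : (a : A) → IsExpectation (λ f → f a)
  return-isExpectation a = record
    { mono   = λ f≤g → f≤g a
    ; homo-+ = λ _ _ → refl
    ; homo-* = λ _ _ → refl
    ; const≈ = λ _ → refl
    }

  bind-isExpectation : {E : (A → ℝ) → ℝ} {F : A → (B → ℝ) → ℝ} →
    IsExpectation E → (∀ a → IsExpectation (F a)) →
    IsExpectation (λ f → E (λ a → F a f))
  bind-isExpectation isE isF = record
    { mono   = λ f≤g → mono isE (λ a → mono (isF a) f≤g)
    ; homo-+ = λ f g → trans (cong isE (λ a → homo-+ (isF a) f g)) (homo-+ isE _ _)
    ; homo-* = λ k f → trans (cong isE (λ a → homo-* (isF a) k f)) (homo-* isE k _)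
    ; const≈ = λ k → trans (cong isE (λ a → const≈ (isF a) k)) (const≈ isE k)
    }

  map-isExpectation : {E : (A → ℝ) → ℝ} (h : A → B) →
    IsExpectation E → IsExpectation (λ f → E (f ∘ h))
  map-isExpectation h isE = bind-isExpectation isE (return-isExpectation ∘ h)

  𝔼-isExpectation : (D : Distribution n) → IsExpectation (𝔼 D)
  𝔼-isExpectation D = record
    { mono   = λ f≤g → sum-mono (λ i → *-monoʳ-≤ (nonneg D i) (f≤g i))
    ; homo-+ = λ f g → trans (sum-cong-≋ (λ i → distribˡ (mass D i) (f i) (g i)))
                             (∑-distrib-+ (λ i → mass D i * f i) (λ i → mass D i * g i))
    ; homo-* = λ k f → trans
        (sum-cong-≋ (λ i → solve 3 (λ a b c → a :* (b :* c) := b :* (a :* c)) refl (mass D i) k (f i)))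
        (sym (*-distribˡ-sum k (λ i → mass D i * f i)))
    ; const≈ = λ k → trans (sym (*-distribʳ-sum k (mass D)))
                           (trans (*-congʳ (total D)) (*-identityˡ k))
    }

  𝔼^-isExpectation : ∀ m (D : Distribution n) → IsExpectation (𝔼^ m D)
  𝔼^-isExpectation zero    D = return-isExpectation []
  𝔼^-isExpectation (suc m) D = bind-isExpectation (𝔼-isExpectation D)
    (λ i → map-isExpectation (i ∷_) (𝔼^-isExpectation m D))

  -- Finite Fubini: `𝔼 D` is a finite weighted sum, and a linear functional passes through it.
  E-𝔼-comm : {E : (A → ℝ) → ℝ} → IsExpectation E → (D : Distribution n) (h : A → Fin n → ℝ) →
    E (λ a → 𝔼 D (h a)) ≈ 𝔼 D (λ i → E (λ a → h a i))
  E-𝔼-comm isE D h = trans (homo-sum isE (λ i a → mass D i * h a i))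
                           (sum-cong-≋ (λ i → homo-* isE (mass D i) (λ a → h a i)))

  𝔼^-+ : ∀ m {m′} (D : Distribution n) (f : Vec (Fin n) m → Vec (Fin n) m′ → ℝ) →
    𝔼^ (m ℕ.+ m′) D (λ zs → f (take m zs) (drop m zs)) ≈ 𝔼^ m D (λ xs → 𝔼^ m′ D (f xs))
  𝔼^-+ zero    D f = refl
  𝔼^-+ (suc m) D f = cong (𝔼-isExpectation D) (λ i → 𝔼^-+ m D (f ∘ (i ∷_)))

  -- An algorithm has a single coin, so two independent coins are packed into one; `remQuot` decodes
  -- the pair of outcomes.
  product : Distribution m → Distribution n → Distribution (m ℕ.* n)
  product {m} {n} D D′ = record
    { mass   = λ k → mass₂ (remQuot n k)
    ; nonneg = λ k → *-nonneg (nonneg D _) (nonneg D′ _)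
    ; total  = begin-equality
        sum (mass₂ ∘ remQuot n)                        ≈⟨ sum-remQuot n mass₂ ⟩
        sum (λ i → sum (λ j → mass D i * mass D′ j))
          ≈⟨ sum-cong-≋ (λ i → *-distribˡ-sum (mass D i) (mass D′)) ⟨
        sum (λ i → mass D i * sum (mass D′))           ≈⟨ *-distribʳ-sum _ (mass D) ⟨
        sum (mass D) * sum (mass D′)                   ≈⟨ *-cong (total D) (total D′) ⟩
        1# * 1#                                        ≈⟨ *-identityˡ 1# ⟩
        1#                                             ∎
    }
    where
    mass₂ : Fin m × Fin n → ℝ
    mass₂ (i , j) = mass D i * mass D′ j

  𝔼-product : (D : Distribution m) (D′ : Distribution n) (f : Fin m × Fin n → ℝ) →
    𝔼 (product D D′) (f ∘ remQuot n) ≈ 𝔼 D (λ i → 𝔼 D′ (λ j → f (i , j)))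
  𝔼-product {m} {n} D D′ f = begin-equality
    sum (weighted ∘ remQuot n)                               ≈⟨ sum-remQuot n weighted ⟩
    sum (λ i → sum (λ j → mass D i * mass D′ j * f (i , j)))
      ≈⟨ sum-cong-≋ (λ i → sum-cong-≋ (λ j → *-assoc (mass D i) (mass D′ j) (f (i , j)))) ⟩
    sum (λ i → sum (λ j → mass D i * (mass D′ j * f (i , j))))
      ≈⟨ sum-cong-≋ (λ i → *-distribˡ-sum (mass D i) (λ j → mass D′ j * f (i , j))) ⟨
    sum (λ i → mass D i * sum (λ j → mass D′ j * f (i , j))) ∎
    where
    weighted : Fin m × Fin n → ℝ
    weighted (i , j) = mass D i * mass D′ j * f (i , j)

  -- Independent runs of two algorithms.

  open Algorithm

  𝔼ᴬ : Distribution n → Algorithm A n m → (A → ℝ) → ℝ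
  𝔼ᴬ {m = m} D T g = 𝔼^ m D (λ xs → 𝔼 (coin T) (λ s → g (run T xs s)))

  𝔼ᴬ-isExpectation : (D : Distribution n) (T : Algorithm A n m) → IsExpectation (𝔼ᴬ D T)
  𝔼ᴬ-isExpectation {m = m} D T = bind-isExpectation (𝔼^-isExpectation m D)
    (λ xs → map-isExpectation (run T xs) (𝔼-isExpectation (coin T)))

  mapᴬ : (A → B) → Algorithm A n m → Algorithm B n m
  mapᴬ h T = record { seeds = seeds T ; coin = coin T ; run = λ xs s → h (run T xs s) }

  infixr 4 _⊗_

  -- The two algorithms read disjoint blocks of the sample and disjoint parts of the seed, which
  -- makes their outputs independent.
  _⊗_ : Algorithm A n m → Algorithm B n m′ → Algorithm (A × B) n (m ℕ.+ m′)
  _⊗_ {m = m} T U = record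
    { seeds = seeds T ℕ.* seeds U
    ; coin  = product (coin T) (coin U)
    ; run   = λ zs k → let (s , t) = remQuot (seeds U) k in
                       run T (take m zs) s , run U (drop m zs) t
    }

  -- Split the joint coin, then split the sample into its two blocks. What remains is to move the
  -- coin of `T` outside the samples of `U`, by exchanging expectations.
  𝔼ᴬ-⊗ : (D : Distribution n) (T : Algorithm A n m) (U : Algorithm B n m′) (g : A × B → ℝ) →
    𝔼ᴬ D (T ⊗ U) g ≈ 𝔼ᴬ D T (λ a → 𝔼ᴬ D U (λ b → g (a , b)))
  𝔼ᴬ-⊗ {m = m} {m′ = m′} D T U g = begin-equality
    𝔼ᴬ D (T ⊗ U) g
      ≈⟨ cong (𝔼^-isExpectation (m ℕ.+ m′) D) (λ zs → 𝔼-product (coin T) (coin U)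
           (λ (s , t) → g (run T (take m zs) s , run U (drop m zs) t))) ⟩
    𝔼^ (m ℕ.+ m′) D (λ zs → f (take m zs) (drop m zs))
      ≈⟨ 𝔼^-+ m D f ⟩
    𝔼^ m D (λ xs → 𝔼^ m′ D (f xs))
      ≈⟨ cong (𝔼^-isExpectation m D) (λ xs → E-𝔼-comm (𝔼^-isExpectation m′ D) (coin T) _) ⟩
    𝔼ᴬ D T (λ a → 𝔼ᴬ D U (λ b → g (a , b))) ∎
    where
    f = λ xs ys → 𝔼 (coin T) (λ s → 𝔼 (coin U) (λ t → g (run T xs s , run U ys t)))

  -- Indicators and probabilities of events.

  𝟙 : {P : Pred A 0ℓ} → Decidable P → A → ℝ
  𝟙 P? a = if does (P? a) then 1# else 0#

  𝟙-nonneg : {P : Pred A 0ℓ} (P? : Decidable P) → ∀ a → 0# ≤ 𝟙 P? a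
  𝟙-nonneg P? a with does (P? a)
  ... | true  = 0≤1
  ... | false = ≤-refl

  𝟙-mono : {P : Pred A 0ℓ} {Q : Pred B 0ℓ} (P? : Decidable P) (Q? : Decidable Q) {a : A} {b : B} →
           (P a → Q b) → 𝟙 P? a ≤ 𝟙 Q? b
  𝟙-mono P? Q? {a} {b} P⇒Q with P? a | Q? b
  ... | no  _ | yes _  = 0≤1
  ... | no  _ | no  _  = ≤-refl
  ... | yes _ | yes _  = ≤-refl
  ... | yes p | no  ¬q = contradiction (P⇒Q p) ¬q

  -- The product of two indicators stands for the conjunction of the events, so an implication from
  -- both events to a third bounds the product of their probabilities once the runs are independent.
  𝟙-*-mono : ∀ {P : Pred A 0ℓ} {Q : Pred B 0ℓ} {C : Set} {S : Pred C 0ℓ}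
    (P? : Decidable P) (Q? : Decidable Q) (S? : Decidable S) {a b c} →
    (P a → Q b → S c) → 𝟙 P? a * 𝟙 Q? b ≤ 𝟙 S? c
  𝟙-*-mono P? Q? S? {a} {b} {c} PQ⇒S with P? a
  ... | no  _ = ≤-trans (≤-reflexive (zeroˡ _)) (𝟙-nonneg S? c)
  ... | yes p = ≤-trans (≤-reflexive (*-identityˡ _)) (𝟙-mono Q? S? (PQ⇒S p))

  Pr-⊗ : {P : Pred A 0ℓ} {Q : Pred B 0ℓ} (P? : Decidable P) (Q? : Decidable Q)
    (D : Distribution n) (T : Algorithm A n m) (U : Algorithm B n m′) →
    𝔼ᴬ D (T ⊗ U) (λ (a , b) → 𝟙 P? a * 𝟙 Q? b) ≈ Pr D T P? * Pr D U Q?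
  Pr-⊗ P? Q? D T U = begin-equality
    𝔼ᴬ D (T ⊗ U) (λ (a , b) → 𝟙 P? a * 𝟙 Q? b)
      ≈⟨ 𝔼ᴬ-⊗ D T U (λ (a , b) → 𝟙 P? a * 𝟙 Q? b) ⟩
    𝔼ᴬ D T (λ a → 𝔼ᴬ D U (λ b → 𝟙 P? a * 𝟙 Q? b))
      ≈⟨ cong (𝔼ᴬ-isExpectation D T) (λ a → homo-* (𝔼ᴬ-isExpectation D U) (𝟙 P? a) (𝟙 Q?)) ⟩
    𝔼ᴬ D T (λ a → 𝟙 P? a * Pr D U Q?)
      ≈⟨ homo-*ʳ (𝔼ᴬ-isExpectation D T) (𝟙 P?) (Pr D U Q?) ⟩
    Pr D T P? * Pr D U Q? ∎

  Pr-⊗ˡ : {P : Pred A 0ℓ} (P? : Decidable P)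
    (D : Distribution n) (T : Algorithm A n m) (U : Algorithm B n m′) →
    𝔼ᴬ D (T ⊗ U) (λ (a , b) → 𝟙 P? a) ≈ Pr D T P?
  Pr-⊗ˡ P? D T U = trans (𝔼ᴬ-⊗ D T U (λ (a , b) → 𝟙 P? a))
    (cong (𝔼ᴬ-isExpectation D T) (λ a → const≈ (𝔼ᴬ-isExpectation D U) (𝟙 P? a)))

  Pr-⊗ʳ : {Q : Pred B 0ℓ} (Q? : Decidable Q)
    (D : Distribution n) (T : Algorithm A n m) (U : Algorithm B n m′) →
    𝔼ᴬ D (T ⊗ U) (λ (a , b) → 𝟙 Q? b) ≈ Pr D U Q?
  Pr-⊗ʳ Q? D T U = trans (𝔼ᴬ-⊗ D T U (λ (a , b) → 𝟙 Q? b)) (const≈ (𝔼ᴬ-isExpectation D T) _)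

  -- Majority vote of three runs.

  module _ {E : (Bool → ℝ) → ℝ} (isE : IsExpectation E) (v : Bool) where

    private
      p = E (𝟙 (Bool._≟ v))
      q = E (𝟙 (Bool._≟ not v))

    -- A function on `Bool` is a combination of the two indicators. Stating it relative to `v`
    -- treats acceptance and rejection by the same argument.
    E-Bool : ∀ g → E g ≈ p * g v + q * g (not v)
    E-Bool g = begin-equality
      E g
        ≈⟨ cong isE (g≈ v) ⟩
      E (λ b → 𝟙 (Bool._≟ v) b * g v + 𝟙 (Bool._≟ not v) b * g (not v))
        ≈⟨ homo-+ isE _ _ ⟩
      E (λ b → 𝟙 (Bool._≟ v) b * g v) + E (λ b → 𝟙 (Bool._≟ not v) b * g (not v))
        ≈⟨ +-cong (homo-*ʳ isE _ (g v)) (homo-*ʳ isE _ (g (not v))) ⟩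
      p * g v + q * g (not v) ∎
      where
      1x+0y : ∀ x y → x ≈ 1# * x + 0# * y
      1x+0y x y = sym (trans (+-cong (*-identityˡ x) (zeroˡ y)) (+-identityʳ x))

      0y+1x : ∀ x y → x ≈ 0# * y + 1# * x
      0y+1x x y = trans (1x+0y x y) (+-comm _ _)

      g≈ : ∀ v b → g b ≈ 𝟙 (Bool._≟ v) b * g v + 𝟙 (Bool._≟ not v) b * g (not v)
      g≈ true  true  = 1x+0y _ _
      g≈ true  false = 0y+1x _ _
      g≈ false true  = 0y+1x _ _
      g≈ false false = 1x+0y _ _

    p+q≈1 : p + q ≈ 1#
    p+q≈1 = begin-equality
      p + q           ≈⟨ +-cong (*-identityʳ p) (*-identityʳ q) ⟨
      p * 1# + q * 1# ≈⟨ E-Bool (const 1#) ⟨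
      E (const 1#)    ≈⟨ const≈ isE 1# ⟩
      1#              ∎

  majority : Bool → Bool → Bool → Bool
  majority x y z = if x then y ∨ z else y ∧ z

  -- Condition on the first vote, then on the second: two equal votes settle the outcome, two
  -- different ones leave it to the third. The right side keeps the unsimplified shape that
  -- `majority-bound` expects.
  𝔼-majority : {E : (Bool → ℝ) → ℝ} → IsExpectation E → ∀ v →
    let p = E (𝟙 (Bool._≟ v))
        q = E (𝟙 (Bool._≟ not v)) in
    E (λ x → E (λ y → E (λ z → 𝟙 (Bool._≟ v) (majority x y z)))) ≈
    p * (p * 1# + q * p) + q * (p * p + q * 0#)
  𝔼-majority {E} isE v = trans (E-Bool isE v _) (+-cong
    (*-congˡ (trans (E-Bool isE v _) (+-cong (*-congˡ (both v)) (*-congˡ (first v)))))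
    (*-congˡ (trans (E-Bool isE v _) (+-cong (*-congˡ (second v)) (*-congˡ (neither v))))))
    where
    both : ∀ v → E (λ z → 𝟙 (Bool._≟ v) (majority v v z)) ≈ 1#
    both true  = const≈ isE 1#
    both false = const≈ isE 1#

    first : ∀ v → E (λ z → 𝟙 (Bool._≟ v) (majority v (not v) z)) ≈ E (𝟙 (Bool._≟ v))
    first true  = refl
    first false = refl

    second : ∀ v → E (λ z → 𝟙 (Bool._≟ v) (majority (not v) v z)) ≈ E (𝟙 (Bool._≟ v))
    second true  = refl
    second false = refl

    neither : ∀ v → E (λ z → 𝟙 (Bool._≟ v) (majority (not v) (not v) z)) ≈ 0#
    neither true  = const≈ isE 0#
    neither false = const≈ isE 0#

  amplify : Algorithm Bool n m → Algorithm Bool n (m ℕ.+ (m ℕ.+ m))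
  amplify T = mapᴬ (λ (x , y , z) → majority x y z) (T ⊗ T ⊗ T)

  Pr-nonneg : {P : Pred A 0ℓ} (P? : Decidable P) (D : Distribution n) (T : Algorithm A n m) →
              0# ≤ Pr D T P?
  Pr-nonneg P? D T = nonneg-E (𝔼ᴬ-isExpectation D T) (𝟙-nonneg P?)

  -- The factor `1# - ⅒` leaves room for the failure probability of the learner, which runs
  -- alongside.
  amplify-correct : (D : Distribution n) (T : Algorithm Bool n m) → ∀ v →
    ⅔ ≤ Pr D T (Bool._≟ v) → ⅔ ≤ Pr D (amplify T) (Bool._≟ v) * (1# - ⅒)
  amplify-correct D T v ⅔≤p = begin
    ⅔ ≤⟨ majority-bound (Pr-nonneg (Bool._≟ not v) D T) (p+q≈1 isE v) ⅔≤p ⟩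
    (p * (p * 1# + q * p) + q * (p * p + q * 0#)) * (1# - ⅒)
      ≈⟨ *-congʳ (𝔼-majority isE v) ⟨
    E (λ x → E (λ y → E (λ z → 𝟙 (Bool._≟ v) (majority x y z)))) * (1# - ⅒)
      ≈⟨ *-congʳ (cong isE (λ x → 𝔼ᴬ-⊗ D T T (λ (y , z) → vote (x , y , z)))) ⟨
    E (λ x → 𝔼ᴬ D (T ⊗ T) (λ (y , z) → vote (x , y , z))) * (1# - ⅒)
      ≈⟨ *-congʳ (𝔼ᴬ-⊗ D T (T ⊗ T) vote) ⟨
    Pr D (amplify T) (Bool._≟ v) * (1# - ⅒) ∎
    where
    E = 𝔼ᴬ D T
    isE = 𝔼ᴬ-isExpectation D T
    p = Pr D T (Bool._≟ v)
    q = Pr D T (Bool._≟ not v)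

    vote : Bool × Bool × Bool → ℝ
    vote (x , y , z) = 𝟙 (Bool._≟ v) (majority x y z)

module Reduction (R : CompleteOrderedField) where

  open CompleteOrderedField R hiding (zero)
  open DistributionTesting R
  open OrderedFieldProperties R
  open Expectations R
  open IsExpectation using (mono)
  open SumProperties semiring using (sum-cong-≋; ∑-distrib-+; sum-replicate-zero)
  open Solver commutativeSemiring using (solve; _:=_; _:+_; _:*_; con)

  private
    variable
      n m k : ℕ

  -- The ℓ₁ metric and distance to a class.

  ‖-‖₁-nonneg : (D D′ : Distribution n) → 0# ≤ ‖ D - D′ ‖₁
  ‖-‖₁-nonneg D D′ = sum-nonneg (λ i → ∣x∣-nonneg (mass D i - mass D′ i))

  ‖D-D‖₁≈0 : (D : Distribution n) → ‖ D - D ‖₁ ≈ 0#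
  ‖D-D‖₁≈0 {n} D = trans (sum-cong-≋ (λ i → ∣x-x∣≈0 (mass D i))) (sum-replicate-zero n)

  ‖-‖₁-sym : (D D′ : Distribution n) → ‖ D - D′ ‖₁ ≈ ‖ D′ - D ‖₁
  ‖-‖₁-sym D D′ = sum-cong-≋ (λ i → ∣x-y∣≈∣y-x∣ (mass D i) (mass D′ i))

  ‖-‖₁-triangle : (D D′ D″ : Distribution n) → ‖ D - D″ ‖₁ ≤ ‖ D - D′ ‖₁ + ‖ D′ - D″ ‖₁
  ‖-‖₁-triangle D D′ D″ = ≤-trans
    (sum-mono (λ i → ∣-∣-triangle (mass D i) (mass D′ i) (mass D″ i)))
    (≤-reflexive (∑-distrib-+ (λ i → ∣ mass D i - mass D′ i ∣) (λ i → ∣ mass D′ i - mass D″ i ∣)))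

  module _ (C : Class) where

    ∈⇒ℓ₁≈0 : {D : Distribution n} → C n D → ℓ₁ C D 0#
    ∈⇒ℓ₁≈0 {D = D} D∈C =
      (λ (D′ , _) → ‖-‖₁-nonneg D D′) ,
      (λ b b≤ → ≤-trans (b≤ (D , D∈C)) (≤-reflexive (‖D-D‖₁≈0 D)))

    -- Since `ℓ₁` is a relation, a value has to be produced first: the member `D′` makes the family
    -- of distances inhabited, 0 bounds it from below, and completeness gives the infimum.
    ℓ₁-exists≤ : {D D′ : Distribution n} → C n D′ → ∃[ x ] ℓ₁ C D x × x ≤ ‖ D - D′ ‖₁
    ℓ₁-exists≤ {D = D} {D′} D′∈C with complete (λ D″ → ‖ D - proj₁ D″ ‖₁) (D′ , D′∈C)
                                                (0# , λ D″ → ‖-‖₁-nonneg D (proj₁ D″))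
    ... | x , isInf = x , isInf , proj₁ isInf (D′ , D′∈C)

    far⇒far-from-each : ∀ {ε} {D D′ : Distribution n} → Far C ε D → C n D′ → ε < ‖ D - D′ ‖₁
    far⇒far-from-each {D = D} far D′∈C with ℓ₁-exists≤ {D = D} D′∈C
    ... | x , isInf , x≤ = <-≤-trans (far x isInf) x≤

    -- The conclusion is doubly negated because the argument is constructive; this is enough when
    -- the final goal is a decidable inequality.
    ¬far⇒¬¬near : ∀ {ε} {D : Distribution n} → ¬ Far C ε D →
                  ¬ ¬ (∃[ x ] ℓ₁ C D x × x ≤ ε)
    ¬far⇒¬¬near ¬far ¬near = ¬far (λ x isInf → ≰⇒> (λ x≤ε → ¬near (x , isInf , x≤ε)))

    -- The rejection condition is phrased as a negation so that `¬-dec` can decide it, as the test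
    -- has to compute it.
    NoneWithin : ℝ → Distribution n → Set
    NoneWithin {n} r D = ¬ (∃[ D′ ] C n D′ × ‖ D - D′ ‖₁ ≤ r)

    noneWithin? : ∀ r → Decidable (NoneWithin {n} r)
    noneWithin? r D = ¬-dec _

  -- The test for the hard subclass and its correctness.

  combinedTest : {P : Distribution n → Set} → Decidable P →
    Algorithm Bool n m → Algorithm (Distribution n) n k →
    Algorithm Bool n ((m ℕ.+ (m ℕ.+ m)) ℕ.+ k)
  combinedTest reject? T L = mapᴬ (λ (b , D̂) → b ∧ not (does (reject? D̂))) (amplify T ⊗ L)

  module _ {P : Distribution n → Set} (reject? : Decidable P)
           (T : Algorithm Bool n m) (L : Algorithm (Distribution n) n k)
           (D : Distribution n) where

    private
      TL = combinedTest reject? T L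
      isE = 𝔼ᴬ-isExpectation D (amplify T ⊗ L)

    -- Acceptance needs both the amplified tester and the learner to succeed, so their probabilities
    -- multiply; this is where amplification is needed.
    combinedTest-accepts : {Q : Distribution n → Set} (Q? : Decidable Q) →
      (∀ D̂ → Q D̂ → ¬ P D̂) → 1# - ⅒ ≤ Pr D L Q? →
      ⅔ ≤ Pr D T (Bool._≟ true) → ⅔ ≤ Pr D TL (Bool._≟ true)
    combinedTest-accepts Q? Q⇒¬P L-good T-accepts = begin
      ⅔
        ≤⟨ amplify-correct D T true T-accepts ⟩
      Pr D (amplify T) (Bool._≟ true) * (1# - ⅒)
        ≤⟨ *-monoʳ-≤ (Pr-nonneg (Bool._≟ true) D (amplify T)) L-good ⟩
      Pr D (amplify T) (Bool._≟ true) * Pr D L Q?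
        ≈⟨ Pr-⊗ (Bool._≟ true) Q? D (amplify T) L ⟨
      𝔼ᴬ D (amplify T ⊗ L) (λ (b , D̂) → 𝟙 (Bool._≟ true) b * 𝟙 Q? D̂)
        ≤⟨ mono isE (λ (b , D̂) → 𝟙-*-mono (Bool._≟ true) Q? (Bool._≟ true) {a = b} {b = D̂} (accepts b D̂)) ⟩
      Pr D TL (Bool._≟ true) ∎
      where
      accepts : ∀ b D̂ → b ≡ true → _ → b ∧ not (does (reject? D̂)) ≡ true
      accepts true D̂ _ q with reject? D̂
      ... | yes p = contradiction p (Q⇒¬P D̂ q)
      ... | no  _ = ≡.refl

    -- A rejecting majority settles the outcome whatever the learner outputs.
    combinedTest-rejects-T : ⅔ ≤ Pr D T (Bool._≟ false) → ⅔ ≤ Pr D TL (Bool._≟ false)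
    combinedTest-rejects-T T-rejects = begin
      ⅔
        ≤⟨ amplify-correct D T false T-rejects ⟩
      Pr D (amplify T) (Bool._≟ false) * (1# - ⅒)
        ≤⟨ *-monoʳ-≤ (Pr-nonneg (Bool._≟ false) D (amplify T)) 1-⅒≤1 ⟩
      Pr D (amplify T) (Bool._≟ false) * 1#
        ≈⟨ *-identityʳ _ ⟩
      Pr D (amplify T) (Bool._≟ false)
        ≈⟨ Pr-⊗ˡ (Bool._≟ false) D (amplify T) L ⟨
      𝔼ᴬ D (amplify T ⊗ L) (λ (b , D̂) → 𝟙 (Bool._≟ false) b)
        ≤⟨ mono isE (λ (b , D̂) → 𝟙-mono (Bool._≟ false) (Bool._≟ false) {a = b}
             (≡.cong (_∧ not (does (reject? D̂))))) ⟩
      Pr D TL (Bool._≟ false) ∎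

    -- A good hypothesis forces rejection whatever the tester says, and 9/10 already exceeds 2/3.
    combinedTest-rejects-L : {Q : Distribution n → Set} (Q? : Decidable Q) →
      (∀ D̂ → Q D̂ → P D̂) → 1# - ⅒ ≤ Pr D L Q? → ⅔ ≤ Pr D TL (Bool._≟ false)
    combinedTest-rejects-L Q? Q⇒P L-good = begin
      ⅔          ≤⟨ ⅔≤1-⅒ ⟩
      1# - ⅒     ≤⟨ L-good ⟩
      Pr D L Q?  ≈⟨ Pr-⊗ʳ Q? D (amplify T) L ⟨
      𝔼ᴬ D (amplify T ⊗ L) (λ (b , D̂) → 𝟙 Q? D̂)
        ≤⟨ mono isE (λ (b , D̂) → 𝟙-mono Q? (Bool._≟ false) {a = D̂} (rejects b D̂)) ⟩
      Pr D TL (Bool._≟ false) ∎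
      where
      rejects : ∀ b D̂ → _ → b ∧ not (does (reject? D̂)) ≡ false
      rejects false D̂ _ = ≡.refl
      rejects true  D̂ q with reject? D̂
      ... | yes _ = ≡.refl
      ... | no ¬p = contradiction (Q⇒P D̂ q) ¬p

  combinedTest-isTester : (C CHard : Class) → CHard n ⊆ C n → ∀ {c K ε} → 0# ≤ c →
    (T : Algorithm Bool n m) → IsTester C ε T →
    (L : Algorithm (Distribution n) n k) → IsLearner C c K ε ⅒ L →
    IsTester CHard ((c + (K + K)) * ε) (combinedTest (noneWithin? CHard (K * ε)) T L)
  combinedTest-isTester {n} C CHard CHard⊆C {c} {K} {ε} 0≤c T T-tests L L-learns D =
    complete-case , sound-case
    where
    reject? = noneWithin? CHard {n} (K * ε)

    complete-case : CHard n D → ⅔ ≤ Pr D (combinedTest reject? T L) (Bool._≟ true)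
    complete-case D∈CHard = combinedTest-accepts reject? T L D
      (λ D̂ → ‖ D - D̂ ‖₁ ≤? c * 0# + K * ε)
      (λ D̂ ‖D-D̂‖≤ none → none (D , D∈CHard , (begin
        ‖ D̂ - D ‖₁     ≈⟨ ‖-‖₁-sym D̂ D ⟩
        ‖ D - D̂ ‖₁     ≤⟨ ‖D-D̂‖≤ ⟩
        c * 0# + K * ε ≈⟨ trans (+-congʳ (zeroʳ c)) (+-identityˡ _) ⟩
        K * ε          ∎)))
      (L-learns D 0# (∈⇒ℓ₁≈0 C D∈C))
      (proj₁ (T-tests D) D∈C)
      where
      D∈C = CHard⊆C D∈CHard

    module _ (far : Far CHard ((c + (K + K)) * ε) D) where

      near-case : ∀ opt → ℓ₁ C D opt → opt ≤ ε → ⅔ ≤ Pr D (combinedTest reject? T L) (Bool._≟ false)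
      near-case opt isOpt opt≤ε = combinedTest-rejects-L reject? T L D
        (λ D̂ → ‖ D - D̂ ‖₁ ≤? c * opt + K * ε)
        -- A member of `CHard` near `D̂` would be near `D` by the triangle inequality through `D̂`;
        -- the two errors `K * ε` are the learner's and the search radius.
        (λ D̂ ‖D-D̂‖≤ (D′ , D′∈CHard , ‖D̂-D′‖≤) → <⇒≱ (far⇒far-from-each CHard {D = D} far D′∈CHard) (begin
          ‖ D - D′ ‖₁                   ≤⟨ ‖-‖₁-triangle D D̂ D′ ⟩
          ‖ D - D̂ ‖₁ + ‖ D̂ - D′ ‖₁      ≤⟨ +-mono-≤ ‖D-D̂‖≤ ‖D̂-D′‖≤ ⟩
          c * opt + K * ε + K * ε       ≤⟨ +-monoˡ-≤ _ (+-monoˡ-≤ _ (*-monoʳ-≤ 0≤c opt≤ε)) ⟩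
          c * ε + K * ε + K * ε
            ≈⟨ solve 3 (λ c K ε → c :* ε :+ K :* ε :+ K :* ε := (c :+ (K :+ K)) :* ε) refl c K ε ⟩
          (c + (K + K)) * ε             ∎))
        (L-learns D opt isOpt)

      sound-case : ⅔ ≤ Pr D (combinedTest reject? T L) (Bool._≟ false)
      -- The case split on `Far C ε D` is not decidable, but the goal is an inequality between reals
      -- and hence stable under double negation.
      sound-case = decidable-stable (_ ≤? _) λ ¬rejects →
        ¬far⇒¬¬near C {D = D}
          (λ farC → ¬rejects (combinedTest-rejects-T reject? T L D (proj₂ (T-tests D) farC)))
          (λ (opt , isOpt , opt≤ε) → ¬rejects (near-case opt isOpt opt≤ε))

  -- Counting samples.

  -- With η = a/(2A), the hypotheses give 2ηQ′ ≤ aQ ≤ 3m + k and k ≤ ηQ′. Half of the lower bound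
  -- pays for the learner, and the other half leaves ηQ′ ≤ 3m. Here `Q` and `Q′` are the bounds at
  -- the larger and the smaller distance parameter.
  sampleBound : ∀ {a A Q Q′} m k → 0# ≤ a → 0# < A →
    a * Q ≤ fromℕ ((m ℕ.+ (m ℕ.+ m)) ℕ.+ k) → Q′ ≤ A * Q → fromℕ k ≤ a * (A + A) ⁻¹ * Q′ →
    a * (A + A) ⁻¹ * fromℕ 3 ⁻¹ * Q′ ≤ fromℕ m
  sampleBound {a} {A} {Q} {Q′} m k 0≤a 0<A aQ≤ Q′≤AQ k≤ = *-cancelˡ-≤ (fromℕ-pos 2) (begin
    fromℕ 3 * (η * θ * Q′)
      ≈⟨ solve 4 (λ r h t q → r :* (h :* t :* q) := r :* t :* (h :* q)) refl (fromℕ 3) η θ Q′ ⟩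
    fromℕ 3 * θ * (η * Q′)  ≈⟨ *-congʳ (*-inverseʳ (0<x⇒x≉0 (fromℕ-pos 2))) ⟩
    1# * (η * Q′)           ≈⟨ *-identityˡ _ ⟩
    η * Q′                  ≤⟨ *-cancelˡ-≤ 0<A (+-cancelʳ-≤ (A * (η * Q′)) bound) ⟩
    fromℕ 3 * M             ∎)
    where
    η = a * (A + A) ⁻¹
    θ = fromℕ 3 ⁻¹
    M = fromℕ m

    samples : fromℕ ((m ℕ.+ (m ℕ.+ m)) ℕ.+ k) ≈ fromℕ 3 * M + fromℕ k
    samples = begin-equality
      fromℕ ((m ℕ.+ (m ℕ.+ m)) ℕ.+ k) ≈⟨ fromℕ-homo-+ (m ℕ.+ (m ℕ.+ m)) k ⟩
      fromℕ (m ℕ.+ (m ℕ.+ m)) + fromℕ k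
        ≈⟨ +-congʳ (trans (fromℕ-homo-+ m (m ℕ.+ m)) (+-congˡ (fromℕ-homo-+ m m))) ⟩
      M + (M + M) + fromℕ k
        ≈⟨ +-congʳ (solve 1 (λ x → x :+ (x :+ x)
             := (con 1 :+ (con 1 :+ (con 1 :+ con 0))) :* x) refl M) ⟩
      fromℕ 3 * M + fromℕ k ∎

    bound : A * (η * Q′) + A * (η * Q′) ≤ A * (fromℕ 3 * M) + A * (η * Q′)
    bound = begin
      A * (η * Q′) + A * (η * Q′)
        ≈⟨ solve 4 (λ A a i q → A :* (a :* i :* q) :+ A :* (a :* i :* q)
             := (A :+ A) :* i :* (a :* q)) refl A a ((A + A) ⁻¹) Q′ ⟩
      (A + A) * (A + A) ⁻¹ * (a * Q′)
        ≈⟨ *-congʳ (*-inverseʳ (0<x⇒x≉0 (+-pos-nonneg 0<A (<⇒≤ 0<A)))) ⟩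
      1# * (a * Q′)                     ≈⟨ *-identityˡ _ ⟩
      a * Q′                            ≤⟨ *-monoʳ-≤ 0≤a Q′≤AQ ⟩
      a * (A * Q)                       ≈⟨ solve 3 (λ a A q → a :* (A :* q) := A :* (a :* q)) refl a A Q ⟩
      A * (a * Q)                       ≤⟨ *-monoʳ-≤ (<⇒≤ 0<A) aQ≤ ⟩
      A * fromℕ ((m ℕ.+ (m ℕ.+ m)) ℕ.+ k) ≈⟨ *-congˡ samples ⟩
      A * (fromℕ 3 * M + fromℕ k)       ≈⟨ distribˡ A _ _ ⟩
      A * (fromℕ 3 * M) + A * fromℕ k   ≤⟨ +-monoʳ-≤ _ (*-monoʳ-≤ (<⇒≤ 0<A) k≤) ⟩
      A * (fromℕ 3 * M) + A * (η * Q′)  ∎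

-- Passing the lower bound from `CHard` to `C`.

theorem6p1 : (R : CompleteOrderedField) →
    let open CompleteOrderedField R
        open DistributionTesting R in
    (C CHard : Class) →
    (c : ℝ) → 1# ≤ c →
    (qL : ℕ → ℝ → ℝ → ℕ) → SemiAgnosticLearner C c qL →
    (qH : ℕ → ℝ → ℝ) → IsComplexityBound qH →
    (∀ n → CHard n ⊆ C n) → TestingRequires CHard qH →
    LittleO (λ n ε → qL n ε ⅒) qH →
    TestingRequires C qH
theorem6p1 R C CHard c 1≤c qL (K , 0<K , learner) qH qH-bound CHard⊆C
           (a , 0<a , ε₀ , 0<ε₀ , ε₀≤1 , hard) qL≪qH =
  -- The constant is the one from `sampleBound`, free of ε. The threshold is `γ * ε₀` because a
  -- tester for `C` at ε yields one for `CHard` at `B * ε`, which must stay below `ε₀`.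
  η * fromℕ 3 ⁻¹ , *-pos 0<η (⁻¹-pos (fromℕ-pos 2)) ,
  γ * ε₀ , *-pos 0<γ 0<ε₀ , γε₀≤1 , λ ε 0<ε ε≤γε₀ →
    let Bε≤ε₀ = ≤-trans (*-monoʳ-≤ (<⇒≤ 0<B) ε≤γε₀) (≤-reflexive (Bγx≈x ε₀))
        ε≤1   = ≤-trans ε≤γε₀ γε₀≤1
        0<Bε  = *-pos 0<B 0<ε
        N₁ , requires = hard (B * ε) 0<Bε Bε≤ε₀
        N₂ , rescaled = rescale (B * ε) 0<Bε (≤-trans Bε≤ε₀ ε₀≤1)
        N₃ , small    = qL≪qH ε 0<ε ε≤1 η 0<η
    in N₁ ℕ.⊔ N₂ ℕ.⊔ N₃ , λ n N≤n m T T-tests →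
    let N₁⊔N₂≤n = ℕ.m⊔n≤o⇒m≤o (N₁ ℕ.⊔ N₂) N₃ N≤n
        L , L-learns = learner n ε ⅒ 0<ε ε≤1 (⁻¹-pos (fromℕ-pos 9)) ⅒<1
    in sampleBound m (qL n ε ⅒) (<⇒≤ 0<a) 0<A
         (requires n (ℕ.m⊔n≤o⇒m≤o N₁ N₂ N₁⊔N₂≤n) _
           (combinedTest (noneWithin? CHard (K * ε)) T L)
           (combinedTest-isTester C CHard (CHard⊆C n) (≤-trans 0≤1 1≤c) T T-tests L L-learns))
         -- Rescaling by `γ` is applied at `B * ε`, which bounds `qH n ε` by `A * qH n (B * ε)`.
         (≤-respˡ-≈ (IsComplexityBound.cong qH-bound n (γBx≈x ε))
           (rescaled n (ℕ.m⊔n≤o⇒n≤o N₁ N₂ N₁⊔N₂≤n)))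
         (small n (ℕ.m⊔n≤o⇒n≤o (N₁ ℕ.⊔ N₂) N₃ N≤n))
  where
  open CompleteOrderedField R hiding (zero)
  open DistributionTesting R
  open OrderedFieldProperties R
  open Reduction R

  -- The factor lost in the distance parameter. As c ≥ 1, also B ≥ 1, so its inverse `γ` is at most
  -- 1, as `rescalable` demands.
  B = c + (K + K)
  γ = B ⁻¹

  1≤B : 1# ≤ B
  1≤B = ≤-trans 1≤c (x≤x+y (+-nonneg (<⇒≤ 0<K) (<⇒≤ 0<K)))

  0<B : 0# < B
  0<B = <-≤-trans 0<1 1≤B

  0<γ : 0# < γ
  0<γ = ⁻¹-pos 0<B

  γ≤1 : γ ≤ 1#
  γ≤1 = begin
    γ      ≈⟨ *-identityʳ γ ⟨
    γ * 1# ≤⟨ *-monoʳ-≤ (<⇒≤ 0<γ) 1≤B ⟩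
    γ * B  ≈⟨ *-inverseˡ 0<B ⟩
    1#     ∎

  γε₀≤1 : γ * ε₀ ≤ 1#
  γε₀≤1 = ≤-trans (*-mono-≤ 0≤1 (<⇒≤ 0<ε₀) γ≤1 ε₀≤1) (≤-reflexive (*-identityˡ 1#))

  Bγx≈x : ∀ x → B * (γ * x) ≈ x
  Bγx≈x x = trans (sym (*-assoc B γ x))
    (trans (*-congʳ (*-inverseʳ (0<x⇒x≉0 0<B))) (*-identityˡ x))

  γBx≈x : ∀ x → γ * (B * x) ≈ x
  γBx≈x x = trans (sym (*-assoc γ B x)) (trans (*-congʳ (*-inverseˡ 0<B)) (*-identityˡ x))

  rescaling = IsComplexityBound.rescalable qH-bound γ 0<γ γ≤1
  A = proj₁ rescaling
  0<A = proj₁ (proj₂ rescaling)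
  rescale = proj₂ (proj₂ rescaling)

  η = a * (A + A) ⁻¹

  0<η : 0# < η
  0<η = *-pos 0<a (⁻¹-pos (+-pos-nonneg 0<A (<⇒≤ 0<A)))
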